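{- Let $G$ be a connected planar graph (loops and multiple edges allowed) associated to a link shadow $D$, and let $v$ and $e$ denote the number of vertices and edges of $G$, respectively. If $e$ is odd and either $e>2v-1$ or $e<2(v-1)-1$, then $D$ is an $L$-position shadow for the Link Smoothing Game; that is, player $L$ can guarantee a win regardless of whether $L$ moves first or second.
   Context: A link shadow $D$ is a connected link diagram in which under/over information is unspecified at the crossings (called precrossings). Link Smoothing Game on $D$: two players, $K$ (Knot) and $L$ (Link), alternately select a remaining precrossing and replace it by either of its two smoothings (horizontal or vertical), until no precrossings remain. $K$ wins if the final diagram is connected; $L$ wins if it is disconnected (once disconnected, the diagram stays disconnected). Graph of a shadow: checkerboard color the regions of $D$; the (black) graph $G$ has one vertex per black region and one edge per precrossing, joining the black regions meeting there (loops and multi-edges allowed). $G$ is a connected plane graph; the white graph is its planar dual $G^*$. Every connected plane graph arises in this way. Smoothing a precrossing amounts to either deleting the corresponding edge of $G$ (and contracting the dual edge in $G^*$) or contracting it in $G$ (and deleting the dual edge in $G^*$). The shadow is connected if and only if both graphs are connected. Thus, on $G$, players alternately choose a remaining edge and delete or contract it; $L$ wins as soon as a cut edge is deleted or a loop is contracted (the latter deletes a cut edge of the dual), and $K$ wins if all edges are used up without this ever happening. $L$-position means that $L$ has a winning strategy both when moving first and when moving second. -}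

module Defs where

open import Data.Fin.Base using (Fin)
open import Data.Fin.Patterns using (0F; 1F; 2F; 3F)
open import Data.Nat.Base using (ℕ; _+_)
open import Data.Product.Base using (_×_; _,_; ∃)
open import Data.Unit.Base using (⊤)
open import Data.Vec.Base using (Vec; lookup; replicate; _[_]≔_)
open import Function.Bundles using (_⇔_)
open import Function.Definitions using (Surjective)
open import Relation.Binary.Construct.Closure.Equivalence using (EqClosure)
open import Relation.Binary.PropositionalEquality using (_≡_; _≢_; trans; cong)
open import Relation.Nullary.Negation using (¬_)

-- Half-edge (x , i) is the i-th of the four strand ends at crossing x, in
-- counterclockwise order.  It also names the corner at x lying between strand
-- ends i and i + 1, i.e. immediately to the left of the strand leaving x along i.
HalfEdge : ℕ → Set
HalfEdge n = Fin n × Fin 4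

clockwise : ∀ {n} → HalfEdge n → HalfEdge n
clockwise (x , 0F) = x , 3F
clockwise (x , 1F) = x , 0F
clockwise (x , 2F) = x , 1F
clockwise (x , 3F) = x , 2F

data Smoothing : Set where
  horizontal vertical : Smoothing

data CrossingState : Set where
  precrossing : CrossingState
  smoothed    : Smoothing → CrossingState

-- The strand end to which a smoothing joins a given strand end.
partner : Smoothing → Fin 4 → Fin 4
partner horizontal 0F = 1F
partner horizontal 1F = 0F
partner horizontal 2F = 3F
partner horizontal 3F = 2F
partner vertical   0F = 3F
partner vertical   1F = 2F
partner vertical   2F = 1F
partner vertical   3F = 0F

Joined : CrossingState → Fin 4 → Fin 4 → Set
Joined precrossing  i j = ⊤
Joined (smoothed s) i j = partner s i ≡ j

State : ℕ → Set
State n = Vec CrossingState n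

unplayed : ∀ n → State n
unplayed n = replicate n precrossing

-- Every strand end lies on an arc of the diagram, so the diagram is connected
-- precisely when all strand ends are linked along arcs and through crossings.
data Step {n} (arc : HalfEdge n → HalfEdge n) (st : State n) :
          HalfEdge n → HalfEdge n → Set where
  alongArc   : ∀ h → Step arc st h (arc h)
  atCrossing : ∀ x {i j} → Joined (lookup st x) i j → Step arc st (x , i) (x , j)

Connected : ∀ {n} → (HalfEdge n → HalfEdge n) → State n → Set
Connected arc st = ∀ h h′ → EqClosure (Step arc st) h h′

-- Following the boundary of a region with the region on the left: from corner h,
-- traverse the arc leaving along h, then leave the crossing reached along the
-- strand end clockwise from the one of arrival.
data NextCorner {n} (arc : HalfEdge n → HalfEdge n) : HalfEdge n → HalfEdge n → Set where
  next : ∀ h → NextCorner arc h (clockwise (arc h))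

-- A connected 4-regular plane graph, as a combinatorial map.  The regions are the
-- classes of corners under boundary traversal, presented as Fin regions.  The
-- crossingless circle is not represented: n = 0 contradicts euler.
record LinkShadow : Set where
  field
    crossings : ℕ
    arc       : HalfEdge crossings → HalfEdge crossings
    arc-invol : ∀ h → arc (arc h) ≡ h
    arc-free  : ∀ h → arc h ≢ h
    connected : Connected arc (unplayed crossings)

    regions        : ℕ
    region         : HalfEdge crossings → Fin regions
    region-surj    : Surjective _≡_ _≡_ region
    region-classes : ∀ h h′ → region h ≡ region h′ ⇔ EqClosure (NextCorner arc) h h′

    -- Planarity: crossings - 2 * crossings + regions = 2.
    euler : regions ≡ crossings + 2

data Colour : Set where
  black white : Colour

opposite : Colour → Colour
opposite black = white
opposite white = black

-- The arc at strand end h has corner h on one side and corner clockwise h on the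
-- other.
record Checkerboard (D : LinkShadow) : Set where
  open LinkShadow D
  field
    colour      : Fin regions → Colour
    alternating : ∀ h → colour (region (clockwise h)) ≡ opposite (colour (region h))

record Multigraph : Set₁ where
  field
    Vertex : Set
    Edge   : Set
    ends   : Edge → Vertex × Vertex

module _ (D : LinkShadow) (C : Checkerboard D) where
  open LinkShadow D
  open Checkerboard C

  BlackRegion : Set
  BlackRegion = ∃ λ r → colour r ≡ black

  private
    blackAfter : ∀ h → colour (region h) ≡ white → colour (region (clockwise h)) ≡ black
    blackAfter h w = trans (alternating h) (cong opposite w)

    whiteAfter : ∀ h → colour (region h) ≡ black → colour (region (clockwise h)) ≡ white
    whiteAfter h b = trans (alternating h) (cong opposite b)

  blackCorners : Fin crossings → BlackRegion × BlackRegion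
  blackCorners x with colour (region (x , 0F)) in eq
  ... | black = (region (x , 0F) , eq) ,
                (region (x , 2F) , blackAfter (x , 3F) (whiteAfter (x , 0F) eq))
  ... | white = (region (x , 3F) , blackAfter (x , 0F) eq) ,
                (region (x , 1F) ,
                 blackAfter (x , 2F) (whiteAfter (x , 3F) (blackAfter (x , 0F) eq)))

  graphOf : Multigraph
  graphOf = record { Vertex = BlackRegion ; Edge = Fin crossings ; ends = blackCorners }

data Player : Set where
  K L : Player

module SmoothingGame (D : LinkShadow) where
  open LinkShadow D

  Remaining : State crossings → Fin crossings → Set
  Remaining st x = lookup st x ≡ precrossing

  smooth : State crossings → Fin crossings → Smoothing → State crossings
  smooth st x s = st [ x ]≔ smoothed s

  -- LWins p st: L has a winning strategy from st with p to move.
  data LWins : Player → State crossings → Set where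
    finished : ∀ {p st} → (∀ x → ¬ Remaining st x) → ¬ Connected arc st → LWins p st
    moveL    : ∀ {st} x s → Remaining st x → LWins K (smooth st x s) → LWins L st
    moveK    : ∀ {st} → ∃ (Remaining st) →
               (∀ x s → Remaining st x → LWins L (smooth st x s)) → LWins K st

  LPosition : Set
  LPosition = ∀ first → LWins first (unplayed crossings)

open SmoothingGame public using (LPosition)

{-# OPTIONS --safe #-}

-- Fix a colour c.  Every strand end runs along exactly one region of colour c, and
-- in a fully smoothed diagram this region changes along a component only across
-- crossings whose smoothing merges two regions of colour c.  So if N regions have
-- colour c and fewer than N - 1 of these mergers occur, the diagram is disconnected.
-- L always plays the smoothing that merges no regions of colour c, which leaves at
-- most ⌈e/2⌉ mergers, made by K.  By Euler's formula, e > 2v - 1 makes this fewer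
-- than N - 1 for white, and e < 2(v - 1) - 1 does so for black.
module Submission where

open import Defs
open import Axiom.UniquenessOfIdentityProofs using (module Decidable⇒UIP)
open import Data.Fin.Base using (Fin; zero; suc)
open import Data.Fin.Patterns using (0F; 1F; 2F; 3F)
open import Data.Fin.Permutation using (↔⇒≡)
import Data.Fin.Properties as Fin
open import Data.Integer.Base using (+_; _-_; _*_; _<_; _>_)
open import Data.Integer.Properties using (drop‿+<+)
open import Data.List.Base using (List; []; _∷_; length; map; filter; allFin)
open import Data.List.Membership.Propositional using (_∈_)
open import Data.List.Membership.Propositional.Properties
  using (∈-filter⁺; ∈-filter⁻; ∈-allFin; ∈-map⁺; ∈-map⁻)
open import Data.List.Membership.Propositional.Properties.WithK using (unique∧set⇒bag)
open import Data.List.Properties using (filter-all; length-tabulate; length-map)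
open import Data.List.Relation.Binary.BagAndSetEquality using (∼bag⇒↭)
open import Data.List.Relation.Binary.Permutation.Propositional.Properties using (↭-length)
open import Data.List.Relation.Unary.All as All using (All; []; _∷_)
import Data.List.Relation.Unary.All.Properties as All
open import Data.List.Relation.Unary.AllPairs using ([]; _∷_)
open import Data.List.Relation.Unary.Any using (here; there)
open import Data.List.Relation.Unary.Unique.Propositional using (Unique)
import Data.List.Relation.Unary.Unique.Propositional.Properties as Unique
open import Data.Nat.Base as ℕ using (ℕ; zero; suc; ⌊_/2⌋; ⌈_/2⌉; _≤_; z≤n; s≤s)
open import Data.Nat.Divisibility using (_∤_)
import Data.Nat.Properties as ℕ
open import Data.Product.Base using (_×_; _,_; ∃; ∃₂; proj₁; proj₂)
import Data.Product.Base as Product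
open import Data.Sum.Base using (_⊎_; inj₁; inj₂)
open import Data.Vec.Base as Vec using ([]; _∷_; lookup)
import Data.Vec.Properties as Vec
open import Function.Base using (_∘_; id)
open import Function.Bundles using (_↔_; Injection; Inverse; Equivalence; mk⇔)
open import Function.Properties.Inverse using (↔⇒↣)
open import Relation.Binary.Construct.Closure.Equivalence as EqClosure using (gfold)
open import Relation.Binary.Definitions using (DecidableEquality)
open import Relation.Binary.PropositionalEquality
  using (_≡_; _≢_; refl; sym; trans; cong; subst; isEquivalence)
open import Relation.Nullary.Decidable using (Dec; yes; no; ¬?)
open import Relation.Nullary.Negation using (¬_; contradiction)

-- Contracting edges of a graph with few edges.

Joins : {A B : Set} → (B → A) → B × B → Set
Joins g (p , q) = g p ≡ g q

module _ {A : Set} (_≟_ : DecidableEquality A) where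

  -- Distinct entries allow `p` to occur only once; it is the vertex that a contraction uses up.
  length-filter-≢ : ∀ p {ds} → Unique ds →
                    length ds ≤ suc (length (filter (¬? ∘ (p ≟_)) ds))
  length-filter-≢ p [] = z≤n
  length-filter-≢ p {d ∷ ds} (d∉ds ∷ u) with p ≟ d
  ... | yes refl rewrite filter-all (¬? ∘ (p ≟_)) d∉ds = ℕ.≤-refl
  ... | no _ = s≤s (length-filter-≢ p u)

  redirect : A → A → A → A
  redirect p q x with p ≟ x
  ... | yes _ = q
  ... | no _  = x

  redirect-≢ : ∀ {p} q {x} → p ≢ x → redirect p q x ≡ x
  redirect-≢ {p} q {x} p≢x with p ≟ x
  ... | yes p≡x = contradiction p≡x p≢x
  ... | no _ = refl

  redirect-joins : ∀ p q → redirect p q p ≡ redirect p q q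
  redirect-joins p q with p ≟ p | p ≟ q
  ... | yes _  | yes _ = refl
  ... | yes _  | no _  = refl
  ... | no p≢p | _     = contradiction refl p≢p

  -- A graph with at least two more vertices than edges is disconnected:
  -- contracting an edge costs at most one vertex.  The contractions made so far
  -- are recorded in φ.
  disconnecting : ∀ {B : Set} (φ : B → A) (es : List (B × B)) {ds : List A} →
                  Unique ds → length es ℕ.+ 2 ≤ length ds →
                  ∃ λ (g : A → A) → All (Joins (g ∘ φ)) es ×
                    ∃₂ λ x y → x ∈ ds × y ∈ ds × g x ≢ g y
  disconnecting φ [] {x ∷ y ∷ _} ((x≢y ∷ _) ∷ _) _ =
    id , [] , x , y , here refl , there (here refl) , x≢y
  disconnecting φ [] {_ ∷ []} _ (s≤s ())
  disconnecting φ [] {[]} _ ()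
  disconnecting φ ((p , q) ∷ es) {ds} u size
    -- Contract the first edge by sending `φ p` to `φ q`, and drop `φ p` from `ds`. The redirection
    -- fixes every entry that survives, so the two entries separated by `g` stay separated after
    -- composing with it.
    with g , joins , x , y , x∈ , y∈ , gx≢gy ←
      disconnecting (redirect (φ p) (φ q) ∘ φ) es (Unique.filter⁺ (¬? ∘ (φ p ≟_)) u)
        (ℕ.s≤s⁻¹ (ℕ.≤-trans size (length-filter-≢ (φ p) u)))
    with x∈ds , p≢x ← ∈-filter⁻ (¬? ∘ (φ p ≟_)) {xs = ds} x∈
       | y∈ds , p≢y ← ∈-filter⁻ (¬? ∘ (φ p ≟_)) {xs = ds} y∈ =
    g ∘ redirect (φ p) (φ q) ,
    cong g (redirect-joins (φ p) (φ q)) ∷ joins ,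
    x , y , x∈ds , y∈ds ,
    λ eq → gx≢gy (trans (cong g (sym (redirect-≢ (φ q) p≢x)))
                        (trans eq (cong g (redirect-≢ (φ q) p≢y))))

_≟ᶜ_ : DecidableEquality Colour
black ≟ᶜ black = yes refl
black ≟ᶜ white = no λ ()
white ≟ᶜ black = no λ ()
white ≟ᶜ white = yes refl

opposite-involutive : ∀ c → opposite (opposite c) ≡ c
opposite-involutive black = refl
opposite-involutive white = refl

same⊎opposite : ∀ a c → a ≡ c ⊎ a ≡ opposite c
same⊎opposite black black = inj₁ refl
same⊎opposite black white = inj₂ refl
same⊎opposite white black = inj₂ refl
same⊎opposite white white = inj₁ refl

-- Counting the moves still to come.

remaining : ∀ {n} → State n → ℕ
remaining [] = 0
remaining (precrossing ∷ st) = suc (remaining st)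
remaining (smoothed _  ∷ st) = remaining st

remaining-unplayed : ∀ n → remaining (unplayed n) ≡ n
remaining-unplayed zero    = refl
remaining-unplayed (suc n) = cong suc (remaining-unplayed n)

remaining-smooth : ∀ {n} (st : State n) x s → lookup st x ≡ precrossing →
                   remaining st ≡ suc (remaining (st Vec.[ x ]≔ smoothed s))
remaining-smooth (_ ∷ st)           zero    s refl = refl
remaining-smooth (precrossing ∷ st) (suc x) s eq   = cong suc (remaining-smooth st x s eq)
remaining-smooth (smoothed _ ∷ st)  (suc x) s eq   = remaining-smooth st x s eq

remaining-zero : ∀ {n} (st : State n) → remaining st ≡ 0 → ∀ x → lookup st x ≢ precrossing
remaining-zero (smoothed _ ∷ st) eq (suc x) = remaining-zero st eq x

remaining-suc : ∀ {n} (st : State n) {r} → remaining st ≡ suc r →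
                ∃ λ x → lookup st x ≡ precrossing
remaining-suc (precrossing ∷ st) eq = zero , refl
remaining-suc (smoothed _ ∷ st)  eq = Product.map suc id (remaining-suc st eq)

movesOfK : Player → ℕ → ℕ
movesOfK K r = ⌈ r /2⌉
movesOfK L r = ⌊ r /2⌋

movesOfK≤⌈n/2⌉ : ∀ p n → movesOfK p n ≤ ⌈ n /2⌉
movesOfK≤⌈n/2⌉ K n = ℕ.≤-refl
movesOfK≤⌈n/2⌉ L n = ℕ.⌊n/2⌋≤⌈n/2⌉ n

-- Counting the regions of each colour.

module _ (D : LinkShadow) (C : Checkerboard D) where
  open LinkShadow D
  open Checkerboard C
  open SmoothingGame D hiding (LPosition)

  colourAt : HalfEdge crossings → Colour
  colourAt h = colour (region h)

  hasColour? : ∀ c r → Dec (colour r ≡ c)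
  hasColour? c r = colour r ≟ᶜ c

  regionsOf : Colour → List (Fin regions)
  regionsOf c = filter (hasColour? c) (allFin regions)

  regionsOf-unique : ∀ c → Unique (regionsOf c)
  regionsOf-unique c = Unique.filter⁺ (hasColour? c) (Unique.allFin⁺ regions)

  -- The two colours partition the regions, and Euler's formula gives their total.
  length-regionsOf-black+white :
    length (regionsOf black) ℕ.+ length (regionsOf white) ≡ crossings ℕ.+ 2
  length-regionsOf-black+white =
    trans (split (allFin regions)) (trans (length-tabulate id) euler)
    where
    split : ∀ rs → length (filter (hasColour? black) rs) ℕ.+
                   length (filter (hasColour? white) rs) ≡ length rs
    split [] = refl
    split (r ∷ rs) with colour r
    ... | black = cong suc (split rs)
    ... | white = trans (ℕ.+-suc _ _) (cong suc (split rs))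

  -- Duplicate-free lists with the same members are permutations of each other; the second list here
  -- is the image of `Fin v`.
  length-regionsOf-black : ∀ {v} → Fin v ↔ BlackRegion D C → length (regionsOf black) ≡ v
  length-regionsOf-black {v} iso =
    trans (↭-length (∼bag⇒↭ (unique∧set⇒bag (regionsOf-unique black) unique (mk⇔ to from))))
          (trans (length-map f (allFin v)) (length-tabulate id))
    where
    module I = Inverse iso
    open Decidable⇒UIP _≟ᶜ_ using (≡-irrelevant)

    f : Fin v → Fin regions
    f = proj₁ ∘ I.to

    -- `Colour` has decidable equality, so the proof of blackness carried by a black region is
    -- unique.
    BlackRegion-≡ : ∀ {a b : BlackRegion D C} → proj₁ a ≡ proj₁ b → a ≡ b
    BlackRegion-≡ {_ , p} {_ , q} refl = cong (_ ,_) (≡-irrelevant p q)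

    unique : Unique (map f (allFin v))
    unique = Unique.map⁺ (Injection.injective (↔⇒↣ iso) ∘ BlackRegion-≡) (Unique.allFin⁺ v)

    to : ∀ {r} → r ∈ regionsOf black → r ∈ map f (allFin v)
    to {r} r∈ with _ , b ← ∈-filter⁻ (hasColour? black) {xs = allFin regions} r∈ =
      subst (_∈ map f (allFin v)) (cong proj₁ (I.strictlyInverseˡ (r , b)))
            (∈-map⁺ f (∈-allFin (I.from (r , b))))

    from : ∀ {r} → r ∈ map f (allFin v) → r ∈ regionsOf black
    from r∈ with i , _ , refl ← ∈-map⁻ f r∈ =
      ∈-filter⁺ (hasColour? black) (∈-allFin (f i)) (proj₂ (I.to i))

  region-next : ∀ h → region (clockwise (arc h)) ≡ region h
  region-next h = sym (Equivalence.from (region-classes _ _) (EqClosure.return (next h)))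

  -- Regions of one colour followed along the strands.

  module _ (c : Colour) where

    -- Of the two regions along a strand, the one of colour c.
    side : HalfEdge crossings → Fin regions
    side h with hasColour? c (region h)
    ... | yes _ = region h
    ... | no _  = region (clockwise h)

    side-left : ∀ h → colourAt h ≡ c → side h ≡ region h
    side-left h eq with hasColour? c (region h)
    ... | yes _ = refl
    ... | no ≢c = contradiction eq ≢c

    side-right : ∀ h → colourAt (clockwise h) ≡ c → side h ≡ region (clockwise h)
    side-right h eq with hasColour? c (region h)
    ... | no _ = refl
    ... | yes refl = contradiction (trans (sym (alternating h)) eq) (opposite-≢ _)
      where
      opposite-≢ : ∀ a → opposite a ≢ a
      opposite-≢ black ()
      opposite-≢ white ()

    turn : ∀ h → colourAt h ≡ opposite c → colourAt (clockwise h) ≡ c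
    turn h eq = trans (alternating h) (trans (cong opposite eq) (opposite-involutive c))

    turn² : ∀ h → colourAt h ≡ c → colourAt (clockwise (clockwise h)) ≡ c
    turn² h eq = turn (clockwise h) (trans (alternating h) (cong opposite eq))

    -- The corner `clockwise h` lies between these two strand ends, so both run along it.
    side-turn : ∀ h → colourAt (clockwise h) ≡ c → side h ≡ side (clockwise h)
    side-turn h eq = trans (side-right h eq) (sym (side-left (clockwise h) eq))

    side-onto : ∀ {r} → r ∈ regionsOf c → ∃ λ h → side h ≡ r
    side-onto {r} r∈ with region-surj r | ∈-filter⁻ (hasColour? c) {xs = allFin regions} r∈
    ... | h , onto | _ , colour≡c =
      h , trans (side-left h (trans (cong colour (onto refl)) colour≡c)) (onto refl)

    -- Seen from its other end, an arc has left and right exchanged, but the same two regions beside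
    -- it.
    side-arc : ∀ h → side h ≡ side (arc h)
    side-arc h with same⊎opposite (colourAt h) c
    ... | inj₁ eq = trans (side-left h eq)
          (trans (sym (region-next h))
                 (sym (side-right (arc h) (trans (cong colour (region-next h)) eq))))
    ... | inj₂ eq = trans (side-right h (turn h eq))
          (trans back (sym (side-left (arc h) (trans (cong colour (sym back)) (turn h eq)))))
      where
      back : region (clockwise h) ≡ region (arc h)
      back = trans (cong (region ∘ clockwise) (sym (arc-invol h))) (region-next (arc h))

    -- The corners of colour `c` at a crossing are 0 and 2, or 1 and 3. Joining the two strand ends
    -- that bound each such corner keeps these corners apart: `horizontal` does so in the first
    -- case, `vertical` in the second.
    separating : ∀ x → ∃ λ s → ∀ i → side (x , i) ≡ side (x , partner s i)
    separating x with same⊎opposite (colourAt (x , 0F)) c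
    ... | inj₁ eq = horizontal , λ where
            0F → sym p
            1F → p
            2F → sym q
            3F → q
      where
      p = side-turn (x , 1F) eq
      q = side-turn (x , 3F) (turn² (x , 0F) eq)
    ... | inj₂ eq = vertical , λ where
            0F → p
            1F → sym q
            2F → q
            3F → sym p
      where
      p = side-turn (x , 0F) (turn (x , 0F) eq)
      q = side-turn (x , 2F) (turn² (x , 3F) (turn (x , 0F) eq))

    sep : Fin crossings → Smoothing
    sep = proj₁ ∘ separating

    -- The edge of the colour-c graph at a crossing: its ends are the two
    -- regions of colour c that meet there.
    edge : Fin crossings → Fin regions × Fin regions
    edge x = side (x , 0F) , side (x , 2F)

    -- The separating smoothing never pairs strand ends 0 and 2, so these run along different
    -- corners of colour `c`, and each other end shares its side with one of them.
    joined-sides : ∀ (g : Fin regions → Fin regions) x → Joins g (edge x) →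
                   ∀ i j → g (side (x , i)) ≡ g (side (x , j))
    joined-sides g x eq i j = trans (all i) (sym (all j))
      where
      all : ∀ i → g (side (x , i)) ≡ g (side (x , 0F))
      all with separating x
      ... | horizontal , s = λ where
              0F → refl
              1F → cong g (s 1F)
              2F → sym eq
              3F → trans (cong g (s 3F)) (sym eq)
      ... | vertical , s = λ where
              0F → refl
              1F → trans (cong g (s 1F)) (sym eq)
              2F → sym eq
              3F → cong g (s 3F)

    -- xs are the crossings where the regions of colour c may have been merged.
    SeparatedOutside : List (Fin crossings) → State crossings → Set
    SeparatedOutside xs st =
      ∀ x → Remaining st x ⊎ (lookup st x ≡ smoothed (sep x) ⊎ x ∈ xs)

    -- The edges in `xs` are too few to connect all regions of colour `c`. Some `g` thus respects
    -- these edges and still takes two values on the regions; `g ∘ side` is constant on components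
    -- of the diagram but not on the whole diagram.
    ¬connected : ∀ xs st → SeparatedOutside xs st → (∀ x → ¬ Remaining st x) →
                 length xs ℕ.+ 2 ≤ length (regionsOf c) → ¬ Connected arc st
    ¬connected xs st outside over size conn
      with g , joins , r , r′ , r∈ , r′∈ , gr≢gr′ ←
        disconnecting Fin._≟_ id (map edge xs) (regionsOf-unique c)
          (subst (λ m → m ℕ.+ 2 ≤ _) (sym (length-map edge xs)) size)
      with h  , eq  ← side-onto r∈
         | h′ , eq′ ← side-onto r′∈ =
      gr≢gr′ (trans (cong g (sym eq))
        (trans (gfold isEquivalence (g ∘ side) step (conn h h′)) (cong g eq′)))
      where
      step : ∀ {h h′} → Step arc st h h′ → g (side h) ≡ g (side h′)
      step (alongArc h) = cong g (side-arc h)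
      step (atCrossing x {i} {j} joined) with outside x
      ... | inj₁ rem = contradiction rem (over x)
      ... | inj₂ (inj₂ x∈xs) = joined-sides g x (All.lookup (All.map⁻ joins) x∈xs) i j
      ... | inj₂ (inj₁ eq) with refl ← subst (λ s → Joined s i j) eq joined =
        cong g (proj₂ (separating x) i)

    -- The strategy of L and its invariant.

    outside-sep : ∀ {xs st} x → SeparatedOutside xs st →
                  SeparatedOutside xs (smooth st x (sep x))
    outside-sep {st = st} x outside y with y Fin.≟ x
    ... | yes refl = inj₂ (inj₁ (Vec.lookup∘update x st _))
    ... | no y≢x rewrite Vec.lookup∘update′ y≢x st (smoothed (sep x)) = outside y

    outside-any : ∀ {xs st} x s → SeparatedOutside xs st →
                  SeparatedOutside (x ∷ xs) (smooth st x s)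
    outside-any {st = st} x s outside y with y Fin.≟ x
    ... | yes y≡x = inj₂ (inj₂ (here y≡x))
    ... | no y≢x rewrite Vec.lookup∘update′ y≢x st (smoothed s) with outside y
    ...   | inj₁ rem         = inj₁ rem
    ...   | inj₂ (inj₁ eq)   = inj₂ (inj₁ eq)
    ...   | inj₂ (inj₂ y∈xs) = inj₂ (inj₂ (there y∈xs))

    -- The invariant bounds past mergers plus the future moves of K. A move of K shifts one unit
    -- from the second term to the first; L may answer at any crossing, since only the choice of
    -- smoothing matters.
    separating-wins : ∀ r p st xs → remaining st ≡ r → SeparatedOutside xs st →
                      length xs ℕ.+ movesOfK p r ℕ.+ 2 ≤ length (regionsOf c) → LWins p st
    separating-wins zero p st xs none outside size =
      finished (remaining-zero st none)
        (¬connected xs st outside (remaining-zero st none)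
          (subst (λ m → m ℕ.+ 2 ≤ _)
                 (trans (cong (length xs ℕ.+_) (idle p)) (ℕ.+-identityʳ _)) size))
      where
      idle : ∀ p → movesOfK p 0 ≡ 0
      idle K = refl
      idle L = refl
    separating-wins (suc r) L st xs some outside size
      with x , rem ← remaining-suc st some =
      -- `⌊ suc r /2⌋` is `⌈ r /2⌉` by definition, so `size` carries over unchanged.
      moveL x (sep x) rem (separating-wins r K _ xs
        (ℕ.suc-injective (trans (sym (remaining-smooth st x (sep x) rem)) some))
        (outside-sep {st = st} x outside) size)
    separating-wins (suc r) K st xs some outside size =
      moveK (remaining-suc st some) λ x s rem →
        separating-wins r L _ (x ∷ xs)
          (ℕ.suc-injective (trans (sym (remaining-smooth st x s rem)) some))
          (outside-any {st = st} x s outside)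
          (subst (λ m → m ℕ.+ 2 ≤ length (regionsOf c)) (ℕ.+-suc (length xs) ⌊ r /2⌋) size)

    LPosition-of-colour : ⌈ crossings /2⌉ ℕ.+ 2 ≤ length (regionsOf c) → LPosition D
    LPosition-of-colour size first =
      separating-wins crossings first _ [] (remaining-unplayed crossings)
        (λ x → inj₁ (Vec.lookup-replicate x precrossing))
        (ℕ.≤-trans (ℕ.+-monoˡ-≤ 2 (movesOfK≤⌈n/2⌉ first crossings)) size)

-- Arithmetic of the two bounds, and the conclusion.

e>2v-1⇒v≤⌊e/2⌋ : ∀ v e → + e > + 2 * + v - + 1 → v ≤ ⌊ e /2⌋
e>2v-1⇒v≤⌊e/2⌋ zero    e _   = z≤n
e>2v-1⇒v≤⌊e/2⌋ (suc m) e gt = begin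
  suc m                   ≡⟨ ℕ.n≡⌊n+n/2⌋ (suc m) ⟩
  ⌊ suc m ℕ.+ suc m /2⌋   ≡⟨ cong (λ k → ⌊ suc m ℕ.+ k /2⌋) (sym (ℕ.+-identityʳ (suc m))) ⟩
  -- For positive v the strict integer inequality unfolds to 2v ≤ e.
  ⌊ 2 ℕ.* suc m /2⌋       ≤⟨ ℕ.⌊n/2⌋-mono (drop‿+<+ gt) ⟩
  ⌊ e /2⌋                 ∎
  where open ℕ.≤-Reasoning

e<2[v-1]-1⇒⌈e/2⌉+2≤v : ∀ v e → + e < + 2 * (+ v - + 1) - + 1 → ⌈ e /2⌉ ℕ.+ 2 ≤ v
-- For v below 2 the bound on e is negative, so no such e exists. For v = k + 2 it reads e < 2k + 1.
e<2[v-1]-1⇒⌈e/2⌉+2≤v (suc (suc k)) e lt = begin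
  ⌈ e /2⌉ ℕ.+ 2               ≡⟨ ℕ.+-comm _ 2 ⟩
  2 ℕ.+ ⌊ suc e /2⌋           ≤⟨ ℕ.+-monoʳ-≤ 2 (ℕ.⌊n/2⌋-mono (drop‿+<+ lt)) ⟩
  2 ℕ.+ ⌊ k ℕ.+ (suc (k ℕ.+ 0)) /2⌋ ≡⟨ cong (λ m → 2 ℕ.+ ⌊ m /2⌋)
                                    (trans (cong (λ m → k ℕ.+ suc m) (ℕ.+-identityʳ k)) (ℕ.+-suc k k)) ⟩
  2 ℕ.+ ⌈ k ℕ.+ k /2⌉         ≡⟨ cong (2 ℕ.+_) (sym (ℕ.n≡⌈n+n/2⌉ k)) ⟩
  suc (suc k)                 ∎
  where open ℕ.≤-Reasoning

corollary7 : (D : LinkShadow) (C : Checkerboard D) (v e : ℕ) →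
    Fin v ↔ Multigraph.Vertex (graphOf D C) →
    Fin e ↔ Multigraph.Edge (graphOf D C) →
    2 ∤ e →
    (+ e > + 2 * + v - + 1) ⊎ (+ e < + 2 * (+ v - + 1) - + 1) →
    LPosition D
corollary7 D C v e vertices edges _ bound with refl ← ↔⇒≡ edges
  with bound
... | inj₂ few = LPosition-of-colour D C black
      (subst (⌈ e /2⌉ ℕ.+ 2 ≤_) (sym (length-regionsOf-black D C vertices))
             (e<2[v-1]-1⇒⌈e/2⌉+2≤v v e few))
-- There are e + 2 - v white regions, hence at least ⌈e/2⌉ + 2 once v is at most ⌊e/2⌋.
... | inj₁ many = LPosition-of-colour D C white (ℕ.+-cancelˡ-≤ v _ _ (begin
      v ℕ.+ (⌈ e /2⌉ ℕ.+ 2)         ≤⟨ ℕ.+-monoˡ-≤ _ (e>2v-1⇒v≤⌊e/2⌋ v e many) ⟩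
      ⌊ e /2⌋ ℕ.+ (⌈ e /2⌉ ℕ.+ 2)   ≡⟨ sym (ℕ.+-assoc ⌊ e /2⌋ _ 2) ⟩
      ⌊ e /2⌋ ℕ.+ ⌈ e /2⌉ ℕ.+ 2     ≡⟨ cong (ℕ._+ 2) (ℕ.⌊n/2⌋+⌈n/2⌉≡n e) ⟩
      e ℕ.+ 2                       ≡⟨ sym (length-regionsOf-black+white D C) ⟩
      length (regionsOf D C black) ℕ.+ length (regionsOf D C white)
                                    ≡⟨ cong (ℕ._+ _) (length-regionsOf-black D C vertices) ⟩
      v ℕ.+ length (regionsOf D C white) ∎))
  where open ℕ.≤-Reasoning
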